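{- Let $q$ be a power of $2$ and let $F$ be a field of characteristic $2$ that contains $\mathbb{F}_q$. Let $L$ be a $q$-polynomial of $q$-degree $n$ in $F[x]$ with distinct roots. Then, unless $q=n=2$, the Galois group of $L$ over $F$, considered as a permutation group on the $q^n-1$ roots of $L(x)/x$, is contained in the alternating group $A_{q^n-1}$.
   Context: A $q$-polynomial over a field $F\supseteq\mathbb{F}_q$ is a polynomial of the form $a_0x+a_1x^q+\cdots+a_nx^{q^n}\in F[x]$; if $a_n\neq0$ its $q$-degree is $n$. -}

module Defs where

open import Level using (Level; _⊔_) renaming (suc to lsuc)
open import Data.Nat as ℕ using (ℕ; zero; suc; _∸_; _%_)
open import Data.Fin as Fin using (Fin; toℕ)
open import Data.Product using (Σ; ∃; _×_; _,_)
open import Relation.Nullary using (¬_; yes; no)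
open import Relation.Binary.PropositionalEquality using (_≡_)
open import Algebra.Bundles using (CommutativeRing)
open import Algebra.Morphism.Structures using (module RingMorphisms)

record Field (c ℓ : Level) : Set (lsuc (c ⊔ ℓ)) where
  field
    commutativeRing : CommutativeRing c ℓ
  open CommutativeRing commutativeRing public
  field
    1≉0     : ¬ (1# ≈ 0#)
    inverse : ∀ x → ¬ (x ≈ 0#) → Σ Carrier (λ y → x * y ≈ 1#)

module _ {c ℓ : Level} (F : Field c ℓ) where
  open Field F

  Char2 : Set ℓ
  Char2 = 1# + 1# ≈ 0#

  pow : Carrier → ℕ → Carrier
  pow x zero    = 1#
  pow x (suc k) = x * pow x k

  Σᶠ : (n : ℕ) → (Fin n → Carrier) → Carrier
  Σᶠ zero    f = 0#
  Σᶠ (suc n) f = f Fin.zero + Σᶠ n (λ i → f (Fin.suc i))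

  record ContainsFieldOfOrder (q : ℕ) : Set (c ⊔ ℓ) where
    field
      ι      : Fin q → Carrier
      ι-inj  : ∀ i j → ι i ≈ ι j → i ≡ j
      has-0  : Σ (Fin q) (λ i → ι i ≈ 0#)
      has-1  : Σ (Fin q) (λ i → ι i ≈ 1#)
      cl-+   : ∀ i j → Σ (Fin q) (λ k → ι i + ι j ≈ ι k)
      cl--   : ∀ i → Σ (Fin q) (λ k → - ι i ≈ ι k)
      cl-*   : ∀ i j → Σ (Fin q) (λ k → ι i * ι j ≈ ι k)
      cl-inv : ∀ i → ¬ (ι i ≈ 0#) → Σ (Fin q) (λ k → ι i * ι k ≈ 1#)

-- A q-polynomial of q-degree n over F: L(x) = Σ_{i=0}^{n} a_i x^{q^i}
-- with a_n ≉ 0, given by its coefficient vector a : Fin (suc n) → F.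
record qPolynomial {c ℓ : Level} (F : Field c ℓ) (q n : ℕ) : Set (c ⊔ ℓ) where
  open Field F
  field
    coeff      : Fin (suc n) → Carrier
    leading≉0  : ¬ (coeff (Fin.fromℕ n) ≈ 0#)

module _ {c₁ ℓ₁ c₂ ℓ₂ : Level} (F : Field c₁ ℓ₁) (K : Field c₂ ℓ₂) where
  private
    module F = Field F
    module K = Field K
  open RingMorphisms F.rawRing K.rawRing public
    using () renaming (IsRingHomomorphism to IsFieldHom)

  evalq : {q n : ℕ} → (F.Carrier → K.Carrier) → qPolynomial F q n → K.Carrier → K.Carrier
  evalq {q} {n} σ L x =
    Σᶠ K (suc n) (λ i → σ (qPolynomial.coeff L i) K.* pow K x (ℕ._^_ q (toℕ i)))

  data Generated {N : ℕ} (σ : F.Carrier → K.Carrier) (r : Fin N → K.Carrier)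
       : K.Carrier → Set (c₁ ⊔ c₂ ⊔ ℓ₂) where
    base : ∀ a {x} → σ a K.≈ x → Generated σ r x
    root : ∀ i {x} → r i K.≈ x → Generated σ r x
    add  : ∀ {x y z} → Generated σ r x → Generated σ r y → x K.+ y K.≈ z → Generated σ r z
    neg  : ∀ {x z} → Generated σ r x → K.- x K.≈ z → Generated σ r z
    mul  : ∀ {x y z} → Generated σ r x → Generated σ r y → x K.* y K.≈ z → Generated σ r z
    inv  : ∀ {x y} → Generated σ r x → x K.* y K.≈ K.1# → Generated σ r y

  -- A splitting field K of the q-polynomial L over F (via the embedding σ),
  -- in which L has q^n distinct roots: 0 together with the q^n - 1 pairwise
  -- distinct nonzero roots r i (the roots of L(x)/x), and K is generated
  -- over σ(F) by these roots.
  record SplittingFieldDistinct {q n : ℕ} (L : qPolynomial F q n) : Set (c₁ ⊔ ℓ₁ ⊔ c₂ ⊔ ℓ₂) where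
    field
      σ      : F.Carrier → K.Carrier
      σ-hom  : IsFieldHom σ
      r      : Fin (ℕ._^_ q n ∸ 1) → K.Carrier
      r-root : ∀ i → evalq σ L (r i) K.≈ K.0#
      r≉0    : ∀ i → ¬ (r i K.≈ K.0#)
      r-inj  : ∀ i j → r i K.≈ r j → i ≡ j
      gen    : ∀ x → Generated σ r x

module _ {c₂ ℓ₂ : Level} (K : Field c₂ ℓ₂) where
  private module K = Field K
  open RingMorphisms K.rawRing K.rawRing public
    using () renaming (IsRingIsomorphism to IsFieldAuto)

sumℕ : (N : ℕ) → (Fin N → ℕ) → ℕ
sumℕ zero    f = 0
sumℕ (suc N) f = f Fin.zero ℕ.+ sumℕ N (λ i → f (Fin.suc i))

inv? : {N : ℕ} → (Fin N → Fin N) → Fin N → Fin N → ℕ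
inv? π i j with i Fin.<? j | π j Fin.<? π i
... | yes _ | yes _ = 1
... | _     | _     = 0

inversions : {N : ℕ} → (Fin N → Fin N) → ℕ
inversions {N} π = sumℕ N (λ i → sumℕ N (λ j → inv? π i j))

IsEven : {N : ℕ} → (Fin N → Fin N) → Set
IsEven π = inversions π % 2 ≡ 0

{-# OPTIONS --safe #-}
module Submission where

-- The roots of L form an elementary abelian 2-group V of order q^n on which τ acts additively.
-- The parity of a permutation π is the parity of the number of unordered pairs whose orientation
-- π reverses, for any choice of orientation. Orient {u, v} by f_w(u), where w = u + v and f_w is
-- an additive functional with f_w(w) = 1. The pairs of difference w then contribute, modulo 2, the
-- sum over u ∈ V of a product of two functionals of u, which is even as soon as 8 divides |V|.
-- What is left is q = 2, n = 1, where there is one nonzero root, and q = 4, n = 1, where π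
-- commutes with the 3-cycle given by multiplication by a generator of 𝔽₄.
-- Equality in K need not be decidable, so V is closed under addition only up to double negation;
-- this suffices because evenness is decidable.

open import Defs
open import Level using (Level; _⊔_; Lift; lift)
open import Algebra.Definitions using (Associative; Commutative; LeftIdentity)
open import Algebra.Morphism.Structures using (module RingMorphisms)
import Algebra.Properties.CommutativeMonoid.Sum as Sum
import Algebra.Properties.Group as GroupProperties
import Algebra.Properties.Ring as RingProperties
import Algebra.Solver.Ring.NaturalCoefficients.Default as SemiringSolver
open import Data.Bool.Base using (Bool; true; false; not; _xor_)
open import Data.Bool.Properties as Boolₚ using (¬-not)
open import Data.Fin using (Fin)
open import Data.Fin.Base as Fin using (zero; suc; toℕ)
open import Data.Fin.Patterns using (0F; 1F; 2F; 3F; 4F)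
open import Data.Fin.Permutation using (Permutation′; permutation)
open import Data.Fin.Properties as Finₚ using (any?; all?; _≟_; injective⇒≤; pigeonhole; punchOut-injective; sequence)
open import Data.List.Base using ([]; _∷_; allFin)
open import Data.List.Membership.Propositional.Properties using (∈-allFin)
open import Data.List.Relation.Unary.All as All using (All; []; _∷_)
open import Data.Nat using (ℕ; _^_; _∸_)
open import Data.Nat.Base as ℕ using (zero; suc; z≤n; s≤s; z<s; s<s)
open import Data.Nat.Divisibility
open import Data.Nat.Properties as ℕₚ using (+-0-commutativeMonoid)
open import Data.Product using (_×_; Σ; ∃; ∃₂; _,_; proj₁; proj₂)
open import Data.Sum using (_⊎_; inj₁; inj₂; [_,_]′)
open import Effect.Monad using (RawMonad)
open import Function.Base using (_∘_; flip; case_of_)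
open import Function.Definitions using (Injective)
open import Relation.Binary.Definitions using (tri<; tri≈; tri>)
open import Relation.Binary.PropositionalEquality as ≡ using (_≡_; _≢_; _≗_)
import Relation.Binary.Reasoning.Setoid as SetoidReasoning
open import Relation.Nullary using (¬_; Dec; yes; no; does; contradiction; ¬?; _⊎-dec_; _×-dec_; _→-dec_)
open import Relation.Nullary.Decidable using (dec-true; dec-false; decidable-stable; from-yes; toWitness)
open import Relation.Nullary.Negation using (¬¬-Monad; ¬¬-map)

module Parity where
  open ≡ using (refl; sym; trans; cong; cong₂; subst; subst₂; module ≡-Reasoning)
  open import Data.Nat.Base using (_+_; _*_; _%_)
  open Sum +-0-commutativeMonoid
    using (sum; sum-cong-≗; ∑-distrib-+; ∑-comm; sum-permute; sum-replicate-zero)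

  private
    variable
      M : ℕ

  -- Finite sums of naturals and self-maps of `Fin M`.

  ⟦_⟧ : Bool → ℕ
  ⟦ false ⟧ = 0
  ⟦ true  ⟧ = 1

  sum₂ : (Fin M → Fin M → ℕ) → ℕ
  sum₂ f = sum (λ i → sum (f i))

  sum₂-cong : {f g : Fin M → Fin M → ℕ} → (∀ i j → f i j ≡ g i j) → sum₂ f ≡ sum₂ g
  sum₂-cong f≗g = sum-cong-≗ (λ i → sum-cong-≗ (f≗g i))

  sum-1 : ∀ M → sum {M} (λ _ → 1) ≡ M
  sum-1 zero    = refl
  sum-1 (suc M) = cong suc (sum-1 M)

  sum₂-distrib-+ : (f g : Fin M → Fin M → ℕ) →
                   sum₂ (λ i j → f i j + g i j) ≡ sum₂ f + sum₂ g
  sum₂-distrib-+ f g =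
    trans (sum-cong-≗ (λ i → ∑-distrib-+ (f i) (g i))) (∑-distrib-+ (sum ∘ f) (sum ∘ g))

  ∣-sum : ∀ d (f : Fin M → ℕ) → (∀ i → d ∣ f i) → d ∣ sum f
  ∣-sum {zero}  d f d∣f = d ∣0
  ∣-sum {suc M} d f d∣f = ∣m∣n⇒∣m+n (d∣f zero) (∣-sum d (f ∘ suc) (d∣f ∘ suc))

  m+m-injective : ∀ {m n} → m + m ≡ n + n → m ≡ n
  m+m-injective {m} {n} eq = ℕₚ.*-cancelˡ-≡ m n 2
    (trans (cong (m +_) (ℕₚ.+-identityʳ m)) (trans eq (cong (n +_) (sym (ℕₚ.+-identityʳ n)))))

  d+d∣m+m⇒d∣m : ∀ {d m} → d + d ∣ m + m → d ∣ m
  d+d∣m+m⇒d∣m {d} {m} = *-cancelˡ-∣ 2 ∘ subst₂ _∣_ (2* d) (2* m)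
    where
    2* : ∀ n → n + n ≡ 2 * n
    2* n = cong (n +_) (sym (ℕₚ.+-identityʳ n))

  -- A missed point `j` could be punched out of the codomain, leaving an injection from `suc M`
  -- points into `M`.
  injective⇒surjective : (f : Fin M → Fin M) → Injective _≡_ _≡_ f → ∀ j → ∃ λ i → f i ≡ j
  injective⇒surjective {suc M} f f-inj j with any? (λ i → f i ≟ j)
  ... | yes fi≡j  = fi≡j
  ... | no  ∄fi≡j = contradiction
    (injective⇒≤ (λ eq → f-inj (punchOut-injective (j≢f _) (j≢f _) eq))) ℕₚ.1+n≰n
    where
    j≢f : ∀ i → j ≢ f i
    j≢f i j≡fi = ∄fi≡j (i , sym j≡fi)

  injective⇒permutation : (f : Fin M → Fin M) → Injective _≡_ _≡_ f → Permutation′ M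
  injective⇒permutation f f-inj =
    permutation f (proj₁ ∘ f-surj) (proj₂ ∘ f-surj) (λ i → f-inj (proj₂ (f-surj (f i))))
    where f-surj = injective⇒surjective f f-inj

  sum-reindex : (f : Fin M → Fin M) → Injective _≡_ _≡_ f → (h : Fin M → ℕ) → sum h ≡ sum (h ∘ f)
  sum-reindex f f-inj h = sum-permute h (injective⇒permutation f f-inj)

  xor-interchange : ∀ w x y z → (w xor x) xor (y xor z) ≡ (w xor y) xor (x xor z)
  xor-interchange w x y z = begin
    (w xor x) xor (y xor z)  ≡⟨ Boolₚ.xor-assoc w x (y xor z) ⟩
    w xor (x xor (y xor z))  ≡⟨ cong (w xor_) (Boolₚ.xor-assoc x y z) ⟨
    w xor ((x xor y) xor z)  ≡⟨ cong (λ b → w xor (b xor z)) (Boolₚ.xor-comm x y) ⟩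
    w xor ((y xor x) xor z)  ≡⟨ cong (w xor_) (Boolₚ.xor-assoc y x z) ⟩
    w xor (y xor (x xor z))  ≡⟨ Boolₚ.xor-assoc w y (x xor z) ⟨
    (w xor y) xor (x xor z)  ∎
    where open ≡-Reasoning

  -- Parity of a permutation via tournaments

  -- An orientation of the complete graph on `Fin M`, Boolean so that a reversed pair is detected by
  -- `_xor_`.
  record Tournament (a : Fin M → Fin M → Bool) : Set where
    field
      irrefl : ∀ i → a i i ≡ false
      asym   : ∀ {i j} → i ≢ j → a j i ≡ not (a i j)

  open Tournament

  tournament-∘ : {a : Fin M → Fin M → Bool} {π : Fin M → Fin M} → Injective _≡_ _≡_ π →
                 Tournament a → Tournament (λ i j → a (π i) (π j))
  tournament-∘ π-inj T .irrefl i  = T .irrefl _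
  tournament-∘ π-inj T .asym  i≢j = T .asym (λ πi≡πj → i≢j (π-inj πi≡πj))

  -- A function on unordered pairs of distinct points, encoded on ordered pairs with value zero on
  -- the diagonal.
  record HollowSymmetric (s : Fin M → Fin M → ℕ) : Set where
    field
      hollow    : ∀ i → s i i ≡ 0
      symmetric : ∀ i j → s j i ≡ s i j

  open HollowSymmetric

  xor-hollowSymmetric : {a b : Fin M → Fin M → Bool} → Tournament a → Tournament b →
                        HollowSymmetric (λ i j → ⟦ a i j xor b i j ⟧)
  xor-hollowSymmetric A B .hollow i rewrite A .irrefl i | B .irrefl i = refl
  xor-hollowSymmetric {a = a} {b} A B .symmetric i j with i ≟ j
  ... | yes refl = refl
  ... | no i≢j rewrite A .asym i≢j | B .asym i≢j with a i j | b i j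
  ...   | false | false = refl
  ...   | false | true  = refl
  ...   | true  | false = refl
  ...   | true  | true  = refl

  pairSum : (Fin M → Fin M → Bool) → (Fin M → Fin M → ℕ) → ℕ
  pairSum a s = sum₂ (λ i j → ⟦ a i j ⟧ * s i j)

  -- Adding the transposed sum brings the two orderings of each pair together, and exactly one of
  -- them is counted by `a`.
  pairSum-double : {a : Fin M → Fin M → Bool} {s : Fin M → Fin M → ℕ} →
                   Tournament a → HollowSymmetric s → pairSum a s + pairSum a s ≡ sum₂ s
  pairSum-double {a = a} {s} A S = begin
    sum₂ p + sum₂ p                  ≡⟨ cong (sum₂ p +_) (∑-comm p) ⟩
    sum₂ p + sum₂ (flip p)           ≡⟨ sum₂-distrib-+ p (flip p) ⟨
    sum₂ (λ i j → p i j + p j i)     ≡⟨ sum₂-cong once ⟩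
    sum₂ s                           ∎
    where
    open ≡-Reasoning
    p = λ i j → ⟦ a i j ⟧ * s i j
    once : ∀ i j → p i j + p j i ≡ s i j
    once i j with i ≟ j
    ... | yes refl rewrite A .irrefl i | S .hollow i = refl
    ... | no i≢j rewrite A .asym i≢j | S .symmetric i j with a i j
    ...   | false = ℕₚ.+-identityʳ (s i j)
    ...   | true  = trans (ℕₚ.+-identityʳ (s i j + 0)) (ℕₚ.+-identityʳ (s i j))

  -- Both doubles are the sum over all ordered pairs, in which no orientation is left.
  pairSum-tournament : {a b : Fin M → Fin M → Bool} {s : Fin M → Fin M → ℕ} →
                       Tournament a → Tournament b → HollowSymmetric s → pairSum a s ≡ pairSum b s
  pairSum-tournament A B S = m+m-injective (trans (pairSum-double A S) (sym (pairSum-double B S)))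

  -- After doubling, both sides run over all ordered pairs, which `π` merely reindexes.
  pairSum-permute : {a : Fin M → Fin M → Bool} {s : Fin M → Fin M → ℕ} {π : Fin M → Fin M} → Injective _≡_ _≡_ π →
                    Tournament a → HollowSymmetric s →
                    pairSum a (λ i j → s (π i) (π j)) ≡ pairSum a s
  pairSum-permute {a = a} {s} {π} π-inj A S = m+m-injective (begin
    pairSum a sπ + pairSum a sπ           ≡⟨ pairSum-double A Sπ ⟩
    sum₂ sπ                               ≡⟨ sum-cong-≗ (λ i → sum-reindex π π-inj (s (π i))) ⟨
    sum (λ i → sum (s (π i)))             ≡⟨ sum-reindex π π-inj (sum ∘ s) ⟨
    sum₂ s                                ≡⟨ pairSum-double A S ⟨
    pairSum a s + pairSum a s             ∎)
    where
    open ≡-Reasoning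
    sπ = λ i j → s (π i) (π j)
    Sπ : HollowSymmetric sπ
    Sπ .hollow i      = S .hollow _
    Sπ .symmetric i j = S .symmetric _ _

  pairSum-distrib-+ : (a : Fin M → Fin M → Bool) (s t : Fin M → Fin M → ℕ) →
                      pairSum a (λ i j → s i j + t i j) ≡ pairSum a s + pairSum a t
  pairSum-distrib-+ a s t = trans
    (sum₂-cong (λ i j → ℕₚ.*-distribˡ-+ ⟦ a i j ⟧ (s i j) (t i j)))
    (sum₂-distrib-+ (λ i j → ⟦ a i j ⟧ * s i j) (λ i j → ⟦ a i j ⟧ * t i j))

  reversals : (Fin M → Fin M → Bool) → (Fin M → Fin M) → ℕ
  reversals a π = pairSum a (λ i j → ⟦ a i j xor a (π i) (π j) ⟧)

  -- The four terms compare neighbours along the closed cycle `w`, `x`, `z`, `y`, and a Boolean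
  -- changes value an even number of times around a cycle.
  xor-cycle-even : ∀ w x y z → 2 ∣ ⟦ x xor z ⟧ + (⟦ w xor x ⟧ + ⟦ y xor z ⟧) + ⟦ w xor y ⟧
  xor-cycle-even false false false false = 2 ∣0
  xor-cycle-even false false false true  = ∣-refl
  xor-cycle-even false false true  false = ∣-refl
  xor-cycle-even false false true  true  = ∣-refl
  xor-cycle-even false true  false false = ∣-refl
  xor-cycle-even false true  false true  = ∣-refl
  xor-cycle-even false true  true  false = divides 2 refl
  xor-cycle-even false true  true  true  = ∣-refl
  xor-cycle-even true  false false false = ∣-refl
  xor-cycle-even true  false false true  = divides 2 refl
  xor-cycle-even true  false true  false = ∣-refl
  xor-cycle-even true  false true  true  = ∣-refl
  xor-cycle-even true  true  false false = ∣-refl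
  xor-cycle-even true  true  false true  = ∣-refl
  xor-cycle-even true  true  true  false = ∣-refl
  xor-cycle-even true  true  true  true  = 2 ∣0

  -- With d = a xor b, the two reversal indicators differ modulo 2 by d + d ∘ π,
  -- and d and d ∘ π have the same sum over unordered pairs.
  reversals-parity : {a b : Fin M → Fin M → Bool} {π : Fin M → Fin M} → Injective _≡_ _≡_ π →
                     Tournament a → Tournament b → 2 ∣ reversals b π → 2 ∣ reversals a π
  reversals-parity {M} {a} {b} {π} π-inj A B 2∣rb =
    ∣m+n∣m⇒∣n (subst (2 ∣_) split even)
      (∣m∣n⇒∣m+n (subst (2 ∣_) (pairSum-tournament B A Sb) 2∣rb) (divides (P d) 2d))
    where
    open ≡-Reasoning
    P = pairSum a
    sa sb d dπ : Fin M → Fin M → ℕ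
    sa i j = ⟦ a i j xor a (π i) (π j) ⟧
    sb i j = ⟦ b i j xor b (π i) (π j) ⟧
    d  i j = ⟦ a i j xor b i j ⟧
    dπ i j = d (π i) (π j)
    D  = xor-hollowSymmetric A B
    Sb = xor-hollowSymmetric B (tournament-∘ π-inj B)

    2d : P d + P dπ ≡ P d * 2
    2d = begin
      P d + P dπ    ≡⟨ cong (P d +_) (pairSum-permute π-inj A D) ⟩
      P d + P d     ≡⟨ cong (P d +_) (ℕₚ.+-identityʳ (P d)) ⟨
      2 * P d       ≡⟨ ℕₚ.*-comm 2 (P d) ⟩
      P d * 2       ∎

    even : 2 ∣ P (λ i j → sb i j + (d i j + dπ i j) + sa i j)
    even = ∣-sum 2 _ λ i → ∣-sum 2 _ λ j → ∣n⇒∣m*n ⟦ a i j ⟧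
      (xor-cycle-even (a i j) (b i j) (a (π i) (π j)) (b (π i) (π j)))

    split : P (λ i j → sb i j + (d i j + dπ i j) + sa i j) ≡ P sb + (P d + P dπ) + P sa
    split = begin
      P (λ i j → sb i j + (d i j + dπ i j) + sa i j)  ≡⟨ pairSum-distrib-+ a (λ i j → sb i j + (d i j + dπ i j)) sa ⟩
      P (λ i j → sb i j + (d i j + dπ i j)) + P sa    ≡⟨ cong (_+ P sa) (pairSum-distrib-+ a sb (λ i j → d i j + dπ i j)) ⟩
      P sb + P (λ i j → d i j + dπ i j) + P sa        ≡⟨ cong (λ p → P sb + p + P sa) (pairSum-distrib-+ a d dπ) ⟩
      P sb + (P d + P dπ) + P sa                      ∎

  _<ᵇ_ : Fin M → Fin M → Bool
  i <ᵇ j = does (i Finₚ.<? j)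

  <ᵇ-tournament : Tournament {M} _<ᵇ_
  <ᵇ-tournament .irrefl i = dec-false (i Finₚ.<? i) (Finₚ.<-irrefl refl)
  <ᵇ-tournament .asym {i} {j} i≢j with Finₚ.<-cmp i j
  ... | tri< i<j _ j≮i = trans (dec-false (j Finₚ.<? i) j≮i) (cong not (sym (dec-true (i Finₚ.<? j) i<j)))
  ... | tri≈ _ i≡j _   = contradiction i≡j i≢j
  ... | tri> i≮j _ j<i = trans (dec-true (j Finₚ.<? i) j<i) (cong not (sym (dec-false (i Finₚ.<? j) i≮j)))

  inv?-<ᵇ : (π : Fin M → Fin M) → ∀ i j → inv? π i j ≡ ⟦ i <ᵇ j ⟧ * ⟦ π j <ᵇ π i ⟧
  inv?-<ᵇ π i j with i Finₚ.<? j | π j Finₚ.<? π i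
  ... | yes i<j | yes πj<πi rewrite dec-true (i Finₚ.<? j) i<j | dec-true (π j Finₚ.<? π i) πj<πi = refl
  ... | yes i<j | no  πj≮πi rewrite dec-true (i Finₚ.<? j) i<j | dec-false (π j Finₚ.<? π i) πj≮πi = refl
  ... | no  i≮j | _         rewrite dec-false (i Finₚ.<? j) i≮j = refl

  sumℕ≡sum : ∀ N (f : Fin N → ℕ) → sumℕ N f ≡ sum f
  sumℕ≡sum zero    f = refl
  sumℕ≡sum (suc N) f = cong (f zero +_) (sumℕ≡sum N (f ∘ suc))

  inversions≡sum₂ : (π : Fin M → Fin M) → inversions π ≡ sum₂ (λ i j → ⟦ i <ᵇ j ⟧ * ⟦ π j <ᵇ π i ⟧)
  inversions≡sum₂ {M} π = trans (sumℕ≡sum M _) (sum-cong-≗ λ i →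
    trans (sumℕ≡sum M _) (sum-cong-≗ (inv?-<ᵇ π i)))

  -- Only pairs with `i <ᵇ j` count. There `_xor_` negates `π i <ᵇ π j`, and since `π` keeps `i` and
  -- `j` distinct, the negation is `π j <ᵇ π i`.
  inversions≡reversals : (π : Fin M → Fin M) → Injective _≡_ _≡_ π → inversions π ≡ reversals _<ᵇ_ π
  inversions≡reversals π π-inj = trans (inversions≡sum₂ π) (sum₂-cong same)
    where
    same : ∀ i j → ⟦ i <ᵇ j ⟧ * ⟦ π j <ᵇ π i ⟧ ≡ ⟦ i <ᵇ j ⟧ * ⟦ (i <ᵇ j) xor (π i <ᵇ π j) ⟧
    same i j with i ≟ j
    ... | yes refl rewrite <ᵇ-tournament .irrefl i = refl
    ... | no i≢j rewrite <ᵇ-tournament .asym (i≢j ∘ π-inj) with i <ᵇ j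
    ...   | false = refl
    ...   | true  = refl

  -- Groups of exponent two

  record BooleanGroup (M : ℕ) : Set where
    infixl 6 _⊕_
    field
      _⊕_         : Fin M → Fin M → Fin M
      𝟘           : Fin M
      ⊕-assoc     : Associative _≡_ _⊕_
      ⊕-comm      : Commutative _≡_ _⊕_
      ⊕-identityˡ : LeftIdentity _≡_ 𝟘 _⊕_
      ⊕-self      : ∀ u → u ⊕ u ≡ 𝟘

  module _ (G : BooleanGroup M) where
    open BooleanGroup G
    open ≡-Reasoning

    ⊕-cancel : ∀ u v → u ⊕ (u ⊕ v) ≡ v
    ⊕-cancel u v = begin
      u ⊕ (u ⊕ v)  ≡⟨ ⊕-assoc u u v ⟨
      u ⊕ u ⊕ v    ≡⟨ cong (_⊕ v) (⊕-self u) ⟩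
      𝟘 ⊕ v        ≡⟨ ⊕-identityˡ v ⟩
      v            ∎

    ⊕-injective : ∀ u → Injective _≡_ _≡_ (u ⊕_)
    ⊕-injective u {v} {w} eq = trans (sym (⊕-cancel u v)) (trans (cong (u ⊕_) eq) (⊕-cancel u w))

    ⊕-swapʳ : ∀ u v w → u ⊕ v ⊕ w ≡ u ⊕ w ⊕ v
    ⊕-swapʳ u v w = trans (⊕-assoc u v w) (trans (cong (u ⊕_) (⊕-comm v w)) (sym (⊕-assoc u w v)))

    ⊕-cancelʳ : ∀ u v → u ⊕ v ⊕ v ≡ u
    ⊕-cancelʳ u v = trans (⊕-comm (u ⊕ v) v) (trans (cong (v ⊕_) (⊕-comm u v)) (⊕-cancel v u))

    ⊕-cancel₂ : ∀ u v t → u ⊕ t ⊕ (v ⊕ t) ≡ u ⊕ v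
    ⊕-cancel₂ u v t = begin
      u ⊕ t ⊕ (v ⊕ t)  ≡⟨ ⊕-assoc (u ⊕ t) v t ⟨
      u ⊕ t ⊕ v ⊕ t    ≡⟨ cong (_⊕ t) (⊕-swapʳ u t v) ⟩
      u ⊕ v ⊕ t ⊕ t    ≡⟨ ⊕-cancelʳ (u ⊕ v) t ⟩
      u ⊕ v            ∎

    -- Additive functionals with values in 𝔽₂.

    Additive : (Fin M → Bool) → Set
    Additive f = ∀ u v → f (u ⊕ v) ≡ f u xor f v

    record SubgroupAvoiding (w : Fin M) : Set₁ where
      field
        H      : Fin M → Set
        H?     : ∀ u → Dec (H u)
        has-𝟘  : H 𝟘
        closed : ∀ {u v} → H u → H v → H (u ⊕ v)
        avoids : ¬ H w

    open SubgroupAvoiding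

    -- If this holds for every `t`, then `H` and its coset by `w` cover the group, so `H` has index
    -- two.
    DecidedBy : ∀ {w} → SubgroupAvoiding w → Fin M → Set
    DecidedBy {w} S t = H S t ⊎ H S (t ⊕ w)

    -- The subgroup generated by `H` and `t` is the union of `H` and its coset by `t`. The
    -- hypothesis on `t ⊕ w` says that `w` is not in this coset.
    adjoin : ∀ {w} (S : SubgroupAvoiding w) t → ¬ H S (t ⊕ w) → SubgroupAvoiding w
    adjoin {w} S t t+w∉H = record
      { H      = λ u → H S u ⊎ H S (u ⊕ t)
      ; H?     = λ u → H? S u ⊎-dec H? S (u ⊕ t)
      ; has-𝟘  = inj₁ (has-𝟘 S)
      ; closed = λ where
          (inj₁ u) (inj₁ v) → inj₁ (closed S u v)
          (inj₁ u) (inj₂ v) → inj₂ (subst (H S) (sym (⊕-assoc _ _ _)) (closed S u v))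
          (inj₂ u) (inj₁ v) → inj₂ (subst (H S) (⊕-swapʳ _ _ _) (closed S u v))
          (inj₂ u) (inj₂ v) → inj₁ (subst (H S) (⊕-cancel₂ _ _ _) (closed S u v))
      ; avoids = [ avoids S , t+w∉H ∘ subst (H S) (⊕-comm w t) ]′
      }

    -- Greedy extension: each `t` with `t ⊕ w` outside `H` is adjoined, and elements decided earlier
    -- stay decided because `H` only grows.
    subgroupAvoiding : ∀ {w} → w ≢ 𝟘 → ∀ ts → Σ (SubgroupAvoiding w) λ S → All (DecidedBy S) ts
    subgroupAvoiding w≢𝟘 [] = record
      { H      = _≡ 𝟘
      ; H?     = _≟ 𝟘
      ; has-𝟘  = refl
      ; closed = λ { refl refl → ⊕-self 𝟘 }
      ; avoids = w≢𝟘
      } , []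
    subgroupAvoiding {w} w≢𝟘 (t ∷ ts) with subgroupAvoiding w≢𝟘 ts
    ... | S , decided with H? S (t ⊕ w)
    ...   | yes t+w∈H = S , inj₂ t+w∈H ∷ decided
    ...   | no  t+w∉H = adjoin S t t+w∉H ,
      inj₁ (inj₂ (subst (H S) (sym (⊕-self t)) (has-𝟘 S))) ∷
      All.map [ inj₁ ∘ inj₁ , inj₂ ∘ inj₁ ]′ decided

    -- A subgroup that is maximal among those avoiding w has index two, so its
    -- complement is the support of an additive functional.
    separating-functional : ∀ {w} → w ≢ 𝟘 → ∃ λ f → Additive f × f w ≡ true
    separating-functional {w} w≢𝟘 with subgroupAvoiding w≢𝟘 (allFin M)
    ... | S , decided = f , additive , dec-true (¬? (H? S w)) (avoids S)
      where
      f : Fin M → Bool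
      f u = does (¬? (H? S u))

      w+u∈H : ∀ {u} → ¬ H S u → H S (u ⊕ w)
      w+u∈H {u} u∉H with All.lookup decided (∈-allFin u)
      ... | inj₁ u∈H   = contradiction u∈H u∉H
      ... | inj₂ u+w∈H = u+w∈H

      additive : Additive f
      additive u v with H? S u | H? S v
      ... | yes u∈H | yes v∈H = dec-false (¬? (H? S (u ⊕ v))) (λ n → n (closed S u∈H v∈H))
      ... | yes u∈H | no  v∉H = dec-true (¬? (H? S (u ⊕ v)))
        (λ u+v∈H → v∉H (subst (H S) (⊕-cancel u v) (closed S u∈H u+v∈H)))
      ... | no  u∉H | yes v∈H = dec-true (¬? (H? S (u ⊕ v)))
        (λ u+v∈H → u∉H (subst (H S) (⊕-cancelʳ u v) (closed S u+v∈H v∈H)))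
      -- Both `u` and `v` lie in the coset of `H` by `w`, so their sum lies in `H`.
      ... | no  u∉H | no  v∉H = dec-false (¬? (H? S (u ⊕ v)))
        (λ n → n (subst (H S) (⊕-cancel₂ u v w) (closed S (w+u∈H u∉H) (w+u∈H v∉H))))

    -- Translation by `t` flips `f` and preserves `k`, so the part of `sum k` where `f` holds equals
    -- the part where it fails.
    sum-halve : ∀ {f t} → Additive f → f t ≡ true → (k : Fin M → ℕ) → (∀ u → k (t ⊕ u) ≡ k u) →
                sum (λ u → ⟦ f u ⟧ * k u) + sum (λ u → ⟦ f u ⟧ * k u) ≡ sum k
    sum-halve {f} {t} f-add ft k k-inv = begin
      sum fk + sum fk                     ≡⟨ cong (sum fk +_) (sum-reindex (t ⊕_) (⊕-injective t) fk) ⟩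
      sum fk + sum (fk ∘ (t ⊕_))          ≡⟨ ∑-distrib-+ fk (fk ∘ (t ⊕_)) ⟨
      sum (λ u → fk u + fk (t ⊕ u))       ≡⟨ sum-cong-≗ once ⟩
      sum k                               ∎
      where
      fk : Fin M → ℕ
      fk u = ⟦ f u ⟧ * k u
      once : ∀ u → fk u + fk (t ⊕ u) ≡ k u
      once u rewrite f-add t u | ft | k-inv u with f u
      ... | false = ℕₚ.+-identityʳ (k u)
      ... | true  = trans (ℕₚ.+-identityʳ (k u + 0)) (ℕₚ.+-identityʳ (k u))

    -- A nonzero functional holds on exactly half of the group, and the zero functional nowhere.
    additive-support : 8 ∣ M → ∀ {f} → Additive f → 4 ∣ sum (⟦_⟧ ∘ f)
    additive-support 8∣M {f} f-add with any? (λ t → f t Boolₚ.≟ true)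
    ... | yes (t , ft) = d+d∣m+m⇒d∣m (subst (8 ∣_) (sym count) 8∣M)
      where
      f*1 : ∀ u → ⟦ f u ⟧ * 1 ≡ ⟦ f u ⟧
      f*1 u = ℕₚ.*-identityʳ ⟦ f u ⟧
      count : sum (⟦_⟧ ∘ f) + sum (⟦_⟧ ∘ f) ≡ M
      count = begin
        sum (⟦_⟧ ∘ f) + sum (⟦_⟧ ∘ f)                          ≡⟨ cong₂ _+_ (sum-cong-≗ f*1) (sum-cong-≗ f*1) ⟨
        sum (λ u → ⟦ f u ⟧ * 1) + sum (λ u → ⟦ f u ⟧ * 1)      ≡⟨ sum-halve {f} f-add ft (λ _ → 1) (λ _ → refl) ⟩
        sum {M} (λ _ → 1)                                      ≡⟨ sum-1 M ⟩
        M                                                      ∎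
    ... | no ∄t = ∣-sum 4 _ λ u → subst (λ b → 4 ∣ ⟦ b ⟧) (sym (¬-not λ fu → ∄t (u , fu))) (4 ∣0)

    -- A product of two functionals has degree at most 2 < dim, so it has even support.
    additive-product-even : 8 ∣ M → ∀ {f g} → Additive f → Additive g →
                            2 ∣ sum (λ u → ⟦ f u ⟧ * ⟦ g u ⟧)
    additive-product-even 8∣M {f} {g} f-add g-add
      with any? (λ t → (f t Boolₚ.≟ true) ×-dec (g t Boolₚ.≟ false))
    -- Translation by `t` flips `f` and preserves `g`, so `f` holds on half of the support of `g`,
    -- whose size is a multiple of 4.
    ... | yes (t , ft , gt) = d+d∣m+m⇒d∣m
      (subst (4 ∣_) (sym (sum-halve f-add ft (⟦_⟧ ∘ g) g-inv)) (additive-support 8∣M g-add))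
      where
      g-inv : ∀ u → ⟦ g (t ⊕ u) ⟧ ≡ ⟦ g u ⟧
      g-inv u rewrite g-add t u | gt = refl
    -- Otherwise `f` implies `g`, so the product is `f` itself.
    ... | no ∄t = subst (2 ∣_) (sum-cong-≗ f≡fg)
      (∣-trans (divides 2 refl) (additive-support 8∣M f-add))
      where
      f≡fg : ∀ u → ⟦ f u ⟧ ≡ ⟦ f u ⟧ * ⟦ g u ⟧
      f≡fg u with f u in fu | g u in gu
      ... | false | _     = refl
      ... | true  | true  = refl
      ... | true  | false = contradiction (u , fu , gu) ∄t

    -- The functional at `𝟘` is a default; being constantly false, it makes `_≺_` irreflexive.
    functional : Fin M → Fin M → Bool
    functional w with w ≟ 𝟘
    ... | yes _   = λ _ → false
    ... | no  w≢𝟘 = proj₁ (separating-functional w≢𝟘)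

    functional-additive : ∀ w → Additive (functional w)
    functional-additive w with w ≟ 𝟘
    ... | yes _   = λ _ _ → refl
    ... | no  w≢𝟘 = proj₁ (proj₂ (separating-functional w≢𝟘))

    functional-𝟘 : ∀ u → functional 𝟘 u ≡ false
    functional-𝟘 u with 𝟘 ≟ 𝟘
    ... | yes _   = refl
    ... | no  𝟘≢𝟘 = contradiction refl 𝟘≢𝟘

    functional-self : ∀ {w} → w ≢ 𝟘 → functional w w ≡ true
    functional-self {w} w≢𝟘 with w ≟ 𝟘
    ... | yes w≡𝟘 = contradiction w≡𝟘 w≢𝟘
    ... | no  w≢𝟘 = proj₂ (proj₂ (separating-functional w≢𝟘))

    _≺_ : Fin M → Fin M → Bool
    u ≺ v = functional (u ⊕ v) u

    -- With `w = u ⊕ v`, the functional of `w` takes different values at `u` and `v`, as their `xor`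
    -- is its value `true` at `w`.
    ≺-tournament : Tournament _≺_
    ≺-tournament .irrefl u = trans (cong (λ w → functional w u) (⊕-self u)) (functional-𝟘 u)
    ≺-tournament .asym {u} {v} u≢v = begin
      functional (v ⊕ u) v              ≡⟨ cong (λ w → functional w v) (⊕-comm v u) ⟩
      functional w v                    ≡⟨ xor-solve (functional w u) (functional w v)
                                             (trans (sym (functional-additive w u v)) (functional-self w≢𝟘)) ⟩
      not (functional w u)              ∎
      where
      w = u ⊕ v
      w≢𝟘 : w ≢ 𝟘
      w≢𝟘 eq = u≢v (⊕-injective u (trans (⊕-self u) (sym eq)))
      xor-solve : ∀ x y → x xor y ≡ true → y ≡ not x
      xor-solve false y eq = eq
      xor-solve true false eq = refl

    automorphism-even : 8 ∣ M → (π : Fin M → Fin M) → Injective _≡_ _≡_ π →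
                        (∀ u v → π (u ⊕ v) ≡ π u ⊕ π v) → 2 ∣ inversions π
    automorphism-even 8∣M π π-inj π-hom =
      subst (2 ∣_) (sym (inversions≡reversals π π-inj))
        (reversals-parity π-inj <ᵇ-tournament ≺-tournament
          (subst (2 ∣_) (sym by-difference) (∣-sum 2 _ λ w →
            additive-product-even 8∣M {functional w} {twisted w} (functional-additive w) (twisted-additive w))))
      where
      -- For the pair `u` and `u ⊕ w`, this tells whether `π` reverses the orientation; as a
      -- function of `u` it is additive because `π` is.
      twisted : Fin M → Fin M → Bool
      twisted w u = functional w u xor functional (π w) (π u)

      twisted-additive : ∀ w → Additive (twisted w)
      twisted-additive w u v
        rewrite functional-additive w u v | π-hom u v | functional-additive (π w) (π u) (π v)
        = xor-interchange (functional w u) (functional w v) (functional (π w) (π u)) (functional (π w) (π v))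

      shift : ∀ u w → ⟦ u ≺ (u ⊕ w) ⟧ * ⟦ (u ≺ (u ⊕ w)) xor (π u ≺ π (u ⊕ w)) ⟧
                    ≡ ⟦ functional w u ⟧ * ⟦ twisted w u ⟧
      shift u w rewrite π-hom u w | ⊕-cancel u w | ⊕-cancel (π u) (π w) = refl

      -- The inner sum is reindexed by `v = u ⊕ w`, then the two sums are exchanged so that the
      -- difference `w` is outermost.
      by-difference : reversals _≺_ π ≡ sum₂ (λ w u → ⟦ functional w u ⟧ * ⟦ twisted w u ⟧)
      by-difference = begin
        reversals _≺_ π
          ≡⟨ sum-cong-≗ (λ u → sum-reindex (u ⊕_) (⊕-injective u) _) ⟩
        sum₂ (λ u w → ⟦ u ≺ (u ⊕ w) ⟧ * ⟦ (u ≺ (u ⊕ w)) xor (π u ≺ π (u ⊕ w)) ⟧)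
          ≡⟨ sum₂-cong shift ⟩
        sum₂ (λ u w → ⟦ functional w u ⟧ * ⟦ twisted w u ⟧)
          ≡⟨ ∑-comm (λ u w → ⟦ functional w u ⟧ * ⟦ twisted w u ⟧) ⟩
        sum₂ (λ w u → ⟦ functional w u ⟧ * ⟦ twisted w u ⟧)
          ∎

  -- Permutations fixing a point and permutations of three points.

  inversions-cong : {π ρ : Fin M → Fin M} → π ≗ ρ → inversions π ≡ inversions ρ
  inversions-cong {π = π} {ρ} π≗ρ = trans (inversions≡sum₂ π) (trans
    (sum₂-cong (λ i j → cong₂ (λ x y → ⟦ i <ᵇ j ⟧ * ⟦ x <ᵇ y ⟧) (π≗ρ j) (π≗ρ i)))
    (sym (inversions≡sum₂ ρ)))

  -- Extends the action on the nonzero roots to all roots, the root 0 having index `zero`.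
  fixing-zero : (Fin M → Fin M) → Fin (suc M) → Fin (suc M)
  fixing-zero π zero    = zero
  fixing-zero π (suc i) = suc (π i)

  -- Index `zero` is least and fixed, so it takes part in no inversion.
  inversions-fixing-zero : (π : Fin M → Fin M) → inversions (fixing-zero π) ≡ inversions π
  inversions-fixing-zero {M} π = begin
    inversions (fixing-zero π)                     ≡⟨ inversions≡sum₂ (fixing-zero π) ⟩
    sum {suc M} (λ j → ⟦ zero <ᵇ j ⟧ * 0) + sum₂ p         ≡⟨ cong (_+ sum₂ p) (sum-cong-≗ {suc M} λ j → ℕₚ.*-zeroʳ ⟦ zero <ᵇ j ⟧) ⟩
    sum {suc M} (λ _ → 0) + sum₂ p                 ≡⟨ cong (_+ sum₂ p) (sum-replicate-zero (suc M)) ⟩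
    sum₂ p                                         ≡⟨ inversions≡sum₂ π ⟨
    inversions π                                   ∎
    where
    open ≡-Reasoning
    p : Fin M → Fin M → ℕ
    p i j = ⟦ i <ᵇ j ⟧ * ⟦ π j <ᵇ π i ⟧

  -- Replaces a function by its three values, so that quantifying over functions becomes a finite
  -- search.
  triple : (x y z : Fin 3) → Fin 3 → Fin 3
  triple x y z 0F = x
  triple x y z 1F = y
  triple x y z 2F = z

  triple-η : (f : Fin 3 → Fin 3) → f ≗ triple (f 0F) (f 1F) (f 2F)
  triple-η f 0F = refl
  triple-η f 1F = refl
  triple-η f 2F = refl

  -- The two conditions on `ρ` force a 3-cycle. A map commuting with it is determined by one value,
  -- so it is a power of `ρ` and even. The finitely many cases are checked by evaluation.
  centralizer-of-3-cycle-even : (ρ π : Fin 3 → Fin 3) → (∀ i → ρ i ≢ i) → (∀ i → ρ (ρ i) ≢ i) →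
                                (∀ i → π (ρ i) ≡ ρ (π i)) → inversions π % 2 ≡ 0
  centralizer-of-3-cycle-even ρ π ρ≢ ρρ≢ comm =
    trans (cong (_% 2) (inversions-cong (triple-η π)))
      (exhaust (ρ 0F) (ρ 1F) (ρ 2F) (π 0F) (π 1F) (π 2F)
        (λ i eq → ρ≢ i (trans (triple-η ρ i) eq))
        (λ i eq → ρρ≢ i (trans (trans (triple-η ρ (ρ i)) (cong ρ′ (triple-η ρ i))) eq))
        (λ i → trans (sym (trans (triple-η π (ρ i)) (cong π′ (triple-η ρ i))))
          (trans (comm i) (trans (triple-η ρ (π i)) (cong ρ′ (triple-η π i))))))
    where
    ρ′ = triple (ρ 0F) (ρ 1F) (ρ 2F)
    π′ = triple (π 0F) (π 1F) (π 2F)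

    exhaust : ∀ x y z u v w → let ρ = triple x y z; π = triple u v w in
              (∀ i → ρ i ≢ i) → (∀ i → ρ (ρ i) ≢ i) →
              (∀ i → π (ρ i) ≡ ρ (π i)) → inversions π % 2 ≡ 0
    exhaust = from-yes (all? λ x → all? λ y → all? λ z → all? λ u → all? λ v → all? λ w →
      let ρ = triple x y z; π = triple u v w in
      all? (λ i → ¬? (ρ i ≟ i)) →-dec (all? (λ i → ¬? (ρ (ρ i) ≟ i)) →-dec
        (all? (λ i → π (ρ i) ≟ ρ (π i)) →-dec (inversions π % 2 ℕₚ.≟ 0))))

open Parity

third-point : (i j : Fin 4) → ∃ λ k → k ≢ i × k ≢ j
third-point = toWitness
  {a? = all? λ i → all? λ j → any? λ k → ¬? (k ≟ i) ×-dec ¬? (k ≟ j)} _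

-- Polynomial functions over a field

module FieldProperties {c ℓ : Level} (K : Field c ℓ) where
  open Field K hiding (zero)
  open RingProperties ring using ([y-z]x≈yx-zx)
  open GroupProperties +-group using (identityʳ-unique)
    renaming (x∙y⁻¹≈ε⇒x≈y to x-y≈0⇒x≈y; x≈y⇒x∙y⁻¹≈ε to x≈y⇒x-y≈0)
  open SemiringSolver commutativeSemiring using (solve; _:+_; _:*_; _:=_)
  open SetoidReasoning setoid

  *-cancel-nonzero : ∀ {x y} → ¬ x ≈ 0# → x * y ≈ 0# → y ≈ 0#
  *-cancel-nonzero {x} {y} x≉0 xy≈0 with inverse x x≉0
  ... | z , xz≈1 = begin
    y            ≈⟨ *-identityˡ y ⟨
    1# * y       ≈⟨ *-congʳ xz≈1 ⟨
    x * z * y    ≈⟨ solve 3 (λ x y z → x :* z :* y := z :* (x :* y)) refl x y z ⟩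
    z * (x * y)  ≈⟨ *-congˡ xy≈0 ⟩
    z * 0#       ≈⟨ zeroʳ z ⟩
    0#           ∎

  -- The difference `x - y` is invertible and annihilates `z`.
  *-injectiveˡ : ∀ {x y z} → ¬ x ≈ y → x * z ≈ y * z → z ≈ 0#
  *-injectiveˡ {x} {y} {z} x≉y xz≈yz = *-cancel-nonzero (x≉y ∘ x-y≈0⇒x≈y x y)
    (trans ([y-z]x≈yx-zx z x y) (x≈y⇒x-y≈0 xz≈yz))

  *-nonzero : ∀ {x y} → ¬ x ≈ 0# → ¬ y ≈ 0# → ¬ x * y ≈ 0#
  *-nonzero x≉0 y≉0 xy≈0 = y≉0 (*-cancel-nonzero x≉0 xy≈0)

  pow-cong : ∀ k {x y} → x ≈ y → pow K x k ≈ pow K y k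
  pow-cong zero    x≈y = refl
  pow-cong (suc k) x≈y = *-cong x≈y (pow-cong k x≈y)

  pow-+ : ∀ x k l → pow K x (k ℕ.+ l) ≈ pow K x k * pow K x l
  pow-+ x zero    l = sym (*-identityˡ _)
  pow-+ x (suc k) l = trans (*-congˡ (pow-+ x k l)) (sym (*-assoc x _ _))

  pow-distrib-* : ∀ x y k → pow K (x * y) k ≈ pow K x k * pow K y k
  pow-distrib-* x y zero    = sym (*-identityˡ 1#)
  pow-distrib-* x y (suc k) = trans (*-congˡ (pow-distrib-* x y k))
    (solve 4 (λ x y p q → x :* y :* (p :* q) := x :* p :* (y :* q)) refl x y (pow K x k) (pow K y k))

  pow-fixed : ∀ {x} q → pow K x q ≈ x → ∀ i → pow K x (q ^ i) ≈ x
  pow-fixed {x} q xq≈x zero    = *-identityʳ x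
  pow-fixed {x} q xq≈x (suc i) = trans (pow-* q) (trans (pow-cong q (pow-fixed q xq≈x i)) xq≈x)
    where
    pow-* : ∀ k → pow K x (k ℕ.* q ^ i) ≈ pow K (pow K x (q ^ i)) k
    pow-* zero    = refl
    pow-* (suc k) = trans (pow-+ x (q ^ i) (k ℕ.* q ^ i)) (*-congˡ (pow-* k))

  Σᶠ-cong : ∀ n {f g : Fin n → Carrier} → (∀ i → f i ≈ g i) → Σᶠ K n f ≈ Σᶠ K n g
  Σᶠ-cong zero    f≈g = refl
  Σᶠ-cong (suc n) f≈g = +-cong (f≈g zero) (Σᶠ-cong n (f≈g ∘ suc))

  Σᶠ-distrib-+ : ∀ n (f g : Fin n → Carrier) → Σᶠ K n (λ i → f i + g i) ≈ Σᶠ K n f + Σᶠ K n g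
  Σᶠ-distrib-+ zero    f g = sym (+-identityˡ 0#)
  Σᶠ-distrib-+ (suc n) f g = trans (+-congˡ (Σᶠ-distrib-+ n (f ∘ suc) (g ∘ suc)))
    (solve 4 (λ x y s t → x :+ y :+ (s :+ t) := x :+ s :+ (y :+ t)) refl (f zero) (g zero) _ _)

  *-distribˡ-Σᶠ : ∀ n x (f : Fin n → Carrier) → Σᶠ K n (λ i → x * f i) ≈ x * Σᶠ K n f
  *-distribˡ-Σᶠ zero    x f = sym (zeroʳ x)
  *-distribˡ-Σᶠ (suc n) x f =
    trans (+-congˡ (*-distribˡ-Σᶠ n x (f ∘ suc))) (sym (distribˡ x (f zero) _))

  -- IsPolynomial d a h: the function h is given by a polynomial of formal degree d whose
  -- coefficient of x^d, possibly zero, is a.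
  IsPolynomial : ℕ → Carrier → (Carrier → Carrier) → Set (c ⊔ ℓ)
  IsPolynomial zero    a h = Lift c (∀ x → h x ≈ a)
  IsPolynomial (suc d) a h = ∃₂ λ b h′ → IsPolynomial d a h′ × (∀ x → h x ≈ b + x * h′ x)

  poly-0 : ∀ d → IsPolynomial d 0# (λ _ → 0#)
  poly-0 zero    = lift λ _ → refl
  poly-0 (suc d) = 0# , (λ _ → 0#) , poly-0 d , λ x → sym (trans (+-identityˡ _) (zeroʳ x))

  poly-+ : ∀ d {a b f g} → IsPolynomial d a f → IsPolynomial d b g →
           IsPolynomial d (a + b) (λ x → f x + g x)
  poly-+ zero    (lift f≈a) (lift g≈b) = lift λ x → +-cong (f≈a x) (g≈b x)
  poly-+ (suc d) (a , f , F , eqf) (b , g , G , eqg) =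
    a + b , (λ x → f x + g x) , poly-+ d F G , λ x → trans (+-cong (eqf x) (eqg x))
      (solve 5 (λ a b x f g → a :+ x :* f :+ (b :+ x :* g) := a :+ b :+ x :* (f :+ g)) refl a b x (f x) (g x))

  poly-lead : ∀ d {a b f} → a ≈ b → IsPolynomial d a f → IsPolynomial d b f
  poly-lead zero    a≈b (lift f≈a)     = lift λ x → trans (f≈a x) a≈b
  poly-lead (suc d) a≈b (c , f , F , eq) = c , f , poly-lead d a≈b F , eq

  poly-shift : ∀ d k {a b} → IsPolynomial d a (λ x → b * pow K x k) →
               IsPolynomial (suc d) a (λ x → b * pow K x (suc k))
  poly-shift d k {a} {b} P = 0# , (λ x → b * pow K x k) , P , λ x → trans
    (solve 3 (λ b x p → b :* (x :* p) := x :* (b :* p)) refl b x (pow K x k)) (sym (+-identityˡ _))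

  poly-monomial : ∀ d b → IsPolynomial d b (λ x → b * pow K x d)
  poly-monomial zero    b = lift λ _ → *-identityʳ b
  poly-monomial (suc d) b = poly-shift d d (poly-monomial d b)

  poly-monomial-< : ∀ {k d} b → k ℕ.< d → IsPolynomial d 0# (λ x → b * pow K x k)
  poly-monomial-< {zero}  {suc d} b k<d = b , (λ _ → 0#) , poly-0 d , λ x →
    trans (*-identityʳ b) (sym (trans (+-congˡ (zeroʳ x)) (+-identityʳ b)))
  poly-monomial-< {suc k} {suc d} b (s<s k<d) = poly-shift d k (poly-monomial-< b k<d)

  poly-Σᶠ : ∀ d n {a} (f : Fin (suc n) → Carrier → Carrier) →
            (∀ i → toℕ i ℕ.< n → IsPolynomial d 0# (f i)) → IsPolynomial d a (f (Fin.fromℕ n)) →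
            IsPolynomial d a (λ x → Σᶠ K (suc n) (λ i → f i x))
  poly-Σᶠ d zero    f low top = poly-lead d (+-identityʳ _) (poly-+ d top (poly-0 d))
  poly-Σᶠ d (suc n) f low top = poly-lead d (+-identityˡ _)
    (poly-+ d (low zero z<s) (poly-Σᶠ d n (f ∘ suc) (λ i i<n → low (suc i) (s<s i<n)) top))

  -- Synthetic division by `x - r`. The identity `h x - h r = (x - r) * h′ x` is written without
  -- subtraction, which suits a semiring solver, and the quotient keeps the top coefficient `a`.
  poly-divide : ∀ d {a h} → IsPolynomial (suc d) a h → ∀ r →
                ∃ λ h′ → IsPolynomial d a h′ × (∀ x → h x + r * h′ x ≈ h r + x * h′ x)
  poly-divide zero {a} {h} (b , f , lift f≈a , eq) r = f , lift f≈a , λ x → begin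
    h x + r * f x            ≈⟨ +-cong (eq x) (*-congˡ (trans (f≈a x) (sym (f≈a r)))) ⟩
    b + x * f x + r * f r    ≈⟨ solve 3 (λ b s t → b :+ s :+ t := b :+ t :+ s) refl b _ _ ⟩
    b + r * f r + x * f x    ≈⟨ +-congʳ (eq r) ⟨
    h r + x * f x            ∎
  poly-divide (suc d) {a} {h} (b , f , F , eq) r with poly-divide d F r
  -- The quotient of `b + x * f x` is `f r + x * g x`, where `g` is the quotient of `f`.
  ... | g , G , f-eq = (λ x → f r + x * g x) , (f r , g , G , λ x → refl) , λ x → begin
    h x + r * (f r + x * g x)                ≈⟨ +-congʳ (eq x) ⟩
    b + x * f x + r * (f r + x * g x)        ≈⟨ solve 6 (λ b x fx r fr gx →
                                                 b :+ x :* fx :+ r :* (fr :+ x :* gx) := b :+ r :* fr :+ x :* (fx :+ r :* gx))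
                                                 refl b x (f x) r (f r) (g x) ⟩
    b + r * f r + x * (f x + r * g x)        ≈⟨ +-cong (sym (eq r)) (*-congˡ (f-eq x)) ⟩
    h r + x * (f r + x * g x)                ∎

  -- Dividing by the first root leaves a quotient with the same top coefficient that vanishes at the
  -- remaining roots.
  too-many-roots : ∀ d {a h} → IsPolynomial d a h → (x : Fin (suc d) → Carrier) →
                   (∀ i j → x i ≈ x j → i ≡ j) → (∀ i → h (x i) ≈ 0#) → a ≈ 0#
  too-many-roots zero    (lift h≈a) x x-inj h≈0 = trans (sym (h≈a (x zero))) (h≈0 zero)
  too-many-roots (suc d) {h = h} P x x-inj h≈0 with poly-divide d P (x zero)
  ... | g , G , eq = too-many-roots d G (x ∘ suc)
    (λ i j xi≈xj → Finₚ.suc-injective (x-inj (suc i) (suc j) xi≈xj))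
    -- At another root both values of `h` vanish, so two distinct roots have the same product with
    -- the value of `g` there, which is therefore zero.
    (λ i → *-injectiveˡ (λ x₀≈xᵢ → Finₚ.0≢1+n (x-inj zero (suc i) x₀≈xᵢ)) (begin
      x zero * g (x (suc i))                  ≈⟨ +-identityˡ _ ⟨
      0# + x zero * g (x (suc i))             ≈⟨ +-congʳ (h≈0 (suc i)) ⟨
      h (x (suc i)) + x zero * g (x (suc i))  ≈⟨ eq (x (suc i)) ⟩
      h (x zero) + x (suc i) * g (x (suc i))  ≈⟨ +-congʳ (h≈0 zero) ⟩
      0# + x (suc i) * g (x (suc i))          ≈⟨ +-identityˡ _ ⟩
      x (suc i) * g (x (suc i))               ∎))

  module _ (char2 : Char2 K) where

    x+x≈0 : ∀ x → x + x ≈ 0#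
    x+x≈0 x = begin
      x + x            ≈⟨ +-cong (*-identityʳ x) (*-identityʳ x) ⟨
      x * 1# + x * 1#  ≈⟨ distribˡ x 1# 1# ⟨
      x * (1# + 1#)    ≈⟨ *-congˡ char2 ⟩
      x * 0#           ≈⟨ zeroʳ x ⟩
      0#               ∎

    x+y≈0⇒x≈y : ∀ {x y} → x + y ≈ 0# → x ≈ y
    x+y≈0⇒x≈y {x} {y} x+y≈0 = begin
      x              ≈⟨ +-identityʳ x ⟨
      x + 0#         ≈⟨ +-congˡ (x+x≈0 y) ⟨
      x + (y + y)    ≈⟨ +-assoc x y y ⟨
      x + y + y      ≈⟨ +-congʳ x+y≈0 ⟩
      0# + y         ≈⟨ +-identityˡ y ⟩
      y              ∎

    square-+ : ∀ x y → (x + y) * (x + y) ≈ x * x + y * y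
    square-+ x y = begin
      (x + y) * (x + y)                  ≈⟨ solve 2 (λ x y → (x :+ y) :* (x :+ y) :=
                                              x :* x :+ y :* y :+ (x :* y :+ x :* y)) refl x y ⟩
      x * x + y * y + (x * y + x * y)    ≈⟨ +-congˡ (x+x≈0 (x * y)) ⟩
      x * x + y * y + 0#                 ≈⟨ +-identityʳ _ ⟩
      x * x + y * y                      ∎

    pow-2^-+ : ∀ k x y → pow K (x + y) (2 ^ k) ≈ pow K x (2 ^ k) + pow K y (2 ^ k)
    pow-2^-+ zero    x y = distribʳ 1# x y
    pow-2^-+ (suc k) x y = begin
      pow K (x + y) (2 ^ suc k)                          ≈⟨ square (x + y) ⟩
      pow K (x + y) (2 ^ k) * pow K (x + y) (2 ^ k)      ≈⟨ *-cong (pow-2^-+ k x y) (pow-2^-+ k x y) ⟩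
      (X + Y) * (X + Y)                                  ≈⟨ square-+ X Y ⟩
      X * X + Y * Y                                      ≈⟨ +-cong (square x) (square y) ⟨
      pow K x (2 ^ suc k) + pow K y (2 ^ suc k)          ∎
      where
      X = pow K x (2 ^ k)
      Y = pow K y (2 ^ k)
      square : ∀ z → pow K z (2 ^ suc k) ≈ pow K z (2 ^ k) * pow K z (2 ^ k)
      square z = trans (pow-+ z (2 ^ k) (2 ^ k ℕ.+ 0))
        (*-congˡ (reflexive (≡.cong (pow K z) (ℕₚ.+-identityʳ (2 ^ k)))))

    -- For `γ` other than 0 and 1, the values 0, 1, `γ`, `γ + 1` and `γ²` lie among four elements,
    -- so two of the five agree. Every coincidence but `γ² = γ + 1` is absurd. The pigeonhole is
    -- applied to indices, where equality is decidable.
    order-4-generator : ContainsFieldOfOrder K 4 → ∃ λ γ → γ * γ ≈ γ + 1#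
    order-4-generator C = γ , (case pigeonhole (ℕₚ.n<1+n 4) index of λ where
      (i , j , i<j , eq) → coincidence i j i<j
        (trans (sym (index-value i)) (trans (reflexive (≡.cong ι eq)) (index-value j))))
      where
      open ContainsFieldOfOrder C
      third = third-point (proj₁ has-0) (proj₁ has-1)
      k     = proj₁ third
      γ     = ι k
      +1    = cl-+ k (proj₁ has-1)

      γ≉0 : ¬ γ ≈ 0#
      γ≉0 γ≈0 = proj₁ (proj₂ third) (ι-inj _ _ (trans γ≈0 (sym (proj₂ has-0))))

      γ≉1 : ¬ γ ≈ 1#
      γ≉1 γ≈1 = proj₂ (proj₂ third) (ι-inj _ _ (trans γ≈1 (sym (proj₂ has-1))))

      value : Fin 5 → Carrier
      value 0F = 0#
      value 1F = 1#
      value 2F = γ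
      value 3F = γ + 1#
      value 4F = γ * γ

      index : Fin 5 → Fin 4
      index 0F = proj₁ has-0
      index 1F = proj₁ has-1
      index 2F = k
      index 3F = proj₁ +1
      index 4F = proj₁ (cl-* k k)

      index-value : ∀ i → ι (index i) ≈ value i
      index-value 0F = proj₂ has-0
      index-value 1F = proj₂ has-1
      index-value 2F = refl
      index-value 3F = trans (sym (proj₂ +1)) (+-congˡ (proj₂ has-1))
      index-value 4F = sym (proj₂ (cl-* k k))

      coincidence : ∀ i j → i Fin.< j → value i ≈ value j → γ * γ ≈ γ + 1#
      coincidence 0F 1F _ eq = contradiction (sym eq) 1≉0
      coincidence 0F 2F _ eq = contradiction (sym eq) γ≉0
      coincidence 0F 3F _ eq = contradiction (x+y≈0⇒x≈y (sym eq)) γ≉1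
      coincidence 0F 4F _ eq = contradiction (sym eq) (*-nonzero γ≉0 γ≉0)
      coincidence 1F 2F _ eq = contradiction (sym eq) γ≉1
      coincidence 1F 3F _ eq = contradiction (identityʳ-unique 1# γ (trans (+-comm 1# γ) (sym eq))) γ≉0
      coincidence 1F 4F _ eq = contradiction
        (trans (square-+ γ 1#) (trans (+-cong (sym eq) (*-identityˡ 1#)) char2))
        (*-nonzero γ+1≉0 γ+1≉0)
        where
        γ+1≉0 : ¬ γ + 1# ≈ 0#
        γ+1≉0 = γ≉1 ∘ x+y≈0⇒x≈y
      coincidence 2F 3F _ eq = contradiction (identityʳ-unique γ 1# (sym eq)) 1≉0
      coincidence 2F 4F _ eq = contradiction
        (*-injectiveˡ γ≉1 (trans (sym eq) (sym (*-identityˡ γ)))) γ≉0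
      coincidence 3F 4F _ eq = sym eq
      coincidence 1F 1F (s≤s ()) _
      coincidence 2F 1F (s≤s ()) _
      coincidence 2F 2F (s≤s (s≤s ())) _
      coincidence 3F 1F (s≤s ()) _
      coincidence 3F 2F (s≤s (s≤s ())) _
      coincidence 3F 3F (s≤s (s≤s (s≤s ()))) _
      coincidence 4F 1F (s≤s ()) _
      coincidence 4F 2F (s≤s (s≤s ())) _
      coincidence 4F 3F (s≤s (s≤s (s≤s ()))) _
      coincidence 4F 4F (s≤s (s≤s (s≤s (s≤s ())))) _

-- The finite case of double-negation shift: `¬ ¬` commutes with conjunctions over `Fin n`.
¬¬-choice : ∀ {p n} {P : Fin n → Set p} → (∀ i → ¬ ¬ P i) → ¬ ¬ (∀ i → P i)
¬¬-choice = sequence (RawMonad.rawApplicative ¬¬-Monad)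

IsEven-stable : ∀ {N} (π : Fin N → Fin N) → ¬ ¬ IsEven π → IsEven π
IsEven-stable π = decidable-stable (inversions π ℕ.% 2 ℕₚ.≟ 0)

-- Homomorphisms of fields.

module _ {c₁ ℓ₁ c₂ ℓ₂ : Level} {F : Field c₁ ℓ₁} {K : Field c₂ ℓ₂} {σ : Field.Carrier F → Field.Carrier K}
  (σ-hom : IsFieldHom F K σ) where
  private module F = Field F
  open Field K hiding (zero)
  open SetoidReasoning setoid
  open RingMorphisms.IsRingHomomorphism σ-hom

  hom-char2 : Char2 F → Char2 K
  hom-char2 char2 = begin
    1# + 1#            ≈⟨ +-cong 1#-homo 1#-homo ⟨
    σ F.1# + σ F.1#    ≈⟨ +-homo F.1# F.1# ⟨
    σ (F.1# F.+ F.1#)  ≈⟨ ⟦⟧-cong char2 ⟩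
    σ F.0#             ≈⟨ 0#-homo ⟩
    0#                 ∎

  -- Otherwise the image of an inverse of `a` would give `1 = 0` in `K`. This keeps the leading
  -- coefficient of `L` nonzero in `K`.
  hom-nonzero : ∀ {a} → ¬ a F.≈ F.0# → ¬ σ a ≈ 0#
  hom-nonzero {a} a≉0 σa≈0 with F.inverse a a≉0
  ... | b , ab≈1 = 1≉0 (begin
    1#          ≈⟨ 1#-homo ⟨
    σ F.1#      ≈⟨ ⟦⟧-cong ab≈1 ⟨
    σ (a F.* b) ≈⟨ *-homo a b ⟩
    σ a * σ b   ≈⟨ *-congʳ σa≈0 ⟩
    0# * σ b    ≈⟨ zeroˡ (σ b) ⟩
    0#          ∎)

-- The roots of a q-polynomial

module Roots {c₁ ℓ₁ c₂ ℓ₂ : Level} {F : Field c₁ ℓ₁} {K : Field c₂ ℓ₂} (char2F : Char2 F)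
  {e n : ℕ} (0<e : 0 ℕ.< e) (L : qPolynomial F (2 ^ e) n) (S : SplittingFieldDistinct F K L)
  where

  open Field K hiding (zero)
  open FieldProperties K
  open SplittingFieldDistinct S
  open qPolynomial L
  open SemiringSolver commutativeSemiring using (solve; _:+_; _:*_; _:=_)
  open SetoidReasoning setoid

  private
    q N : ℕ
    q = 2 ^ e
    N = q ^ n ∸ 1

  -- Ensures `q ^ i < q ^ n` for `i < n`, so that the last term of `L` has the greatest exponent.
  1<q : 1 ℕ.< q
  1<q = ℕₚ.^-monoʳ-< 2 (s<s z<s) 0<e

  char2 : Char2 K
  char2 = hom-char2 {F = F} {K} σ-hom char2F

  L′ : Carrier → Carrier
  L′ = evalq F K σ L

  1+N≡qⁿ : suc N ≡ q ^ n
  1+N≡qⁿ = ℕₚ.m+[n∸m]≡n (ℕₚ.m^n>0 q {{ℕₚ.m^n≢0 2 e}} n)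

  L′-polynomial : IsPolynomial (q ^ n) (σ (coeff (Fin.fromℕ n))) L′
  L′-polynomial = poly-Σᶠ (q ^ n) n (λ i x → σ (coeff i) * pow K x (q ^ toℕ i))
    (λ i i<n → poly-monomial-< (σ (coeff i)) (ℕₚ.^-monoʳ-< q 1<q i<n))
    (≡.subst (λ k → IsPolynomial (q ^ n) top (λ x → top * pow K x (q ^ k)))
      (≡.sym (Finₚ.toℕ-fromℕ n)) (poly-monomial (q ^ n) top))
    where top = σ (coeff (Fin.fromℕ n))

  L′-cong : ∀ {x y} → x ≈ y → L′ x ≈ L′ y
  L′-cong x≈y = Σᶠ-cong (suc n) (λ i → *-congˡ {σ (coeff i)} (pow-cong (q ^ toℕ i) x≈y))

  -- Each exponent `q ^ i` is a power of 2, so each term is a constant times an iterated Frobenius.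
  L′-+ : ∀ x y → L′ (x + y) ≈ L′ x + L′ y
  L′-+ x y = trans (Σᶠ-cong (suc n) term)
    (Σᶠ-distrib-+ (suc n) (λ i → σ (coeff i) * pow K x (q ^ toℕ i)) (λ i → σ (coeff i) * pow K y (q ^ toℕ i)))
    where
    frobenius : ∀ i → pow K (x + y) (q ^ i) ≈ pow K x (q ^ i) + pow K y (q ^ i)
    frobenius i rewrite ℕₚ.^-*-assoc 2 e i = pow-2^-+ char2 (e ℕ.* i) x y
    term : ∀ i → σ (coeff i) * pow K (x + y) (q ^ toℕ i) ≈
                 σ (coeff i) * pow K x (q ^ toℕ i) + σ (coeff i) * pow K y (q ^ toℕ i)
    term i = trans (*-congˡ (frobenius (toℕ i))) (distribˡ _ _ _)

  -- An element with `γ^q = γ` is unchanged by every power `q ^ i`, so it factors out of each term: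
  -- this is the 𝔽_q-linearity of `L`.
  L′-scale : ∀ {γ} → pow K γ q ≈ γ → ∀ x → L′ (γ * x) ≈ γ * L′ x
  L′-scale {γ} γ-fixed x = trans (Σᶠ-cong (suc n) term)
    (*-distribˡ-Σᶠ (suc n) γ (λ i → σ (coeff i) * pow K x (q ^ toℕ i)))
    where
    term : ∀ i → σ (coeff i) * pow K (γ * x) (q ^ toℕ i) ≈ γ * (σ (coeff i) * pow K x (q ^ toℕ i))
    term i = begin
      a * pow K (γ * x) k        ≈⟨ *-congˡ (pow-distrib-* γ x k) ⟩
      a * (pow K γ k * pow K x k) ≈⟨ *-congˡ (*-congʳ (pow-fixed q γ-fixed (toℕ i))) ⟩
      a * (γ * pow K x k)        ≈⟨ solve 3 (λ a γ p → a :* (γ :* p) := γ :* (a :* p)) refl a γ (pow K x k) ⟩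
      γ * (a * pow K x k)        ∎
      where
      a = σ (coeff i)
      k = q ^ toℕ i

  W : Fin (suc N) → Carrier
  W zero    = 0#
  W (suc i) = r i

  W-inj : ∀ i j → W i ≈ W j → i ≡ j
  W-inj zero    zero    _  = ≡.refl
  W-inj zero    (suc j) eq = contradiction (sym eq) (r≉0 j)
  W-inj (suc i) zero    eq = contradiction eq (r≉0 i)
  W-inj (suc i) (suc j) eq = ≡.cong suc (r-inj i j eq)

  W-root : ∀ i → L′ (W i) ≈ 0#
  W-root zero    = trans (L′-cong (sym (+-identityˡ 0#))) (trans (L′-+ 0# 0#) (x+x≈0 char2 (L′ 0#)))
  W-root (suc i) = r-root i

  -- A root `x` missing from the list would give `q ^ n + 1` distinct roots of a polynomial of
  -- degree `q ^ n`, forcing its leading coefficient to vanish. The argument refutes absence without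
  -- locating `x` in the list, whence the double negation.
  W-complete : ∀ {x} → L′ x ≈ 0# → ¬ ¬ ∃ λ k → x ≈ W k
  W-complete {x} L′x≈0 x∉W = hom-nonzero {F = F} {K} σ-hom leading≉0
    (too-many-roots (suc N)
      (≡.subst (λ d → IsPolynomial d (σ (coeff (Fin.fromℕ n))) L′) (≡.sym 1+N≡qⁿ) L′-polynomial)
      points points-inj points-root)
    where
    points : Fin (suc (suc N)) → Carrier
    points zero    = x
    points (suc i) = W i

    points-inj : ∀ i j → points i ≈ points j → i ≡ j
    points-inj zero    zero    _  = ≡.refl
    points-inj zero    (suc j) eq = contradiction (j , eq) x∉W
    points-inj (suc i) zero    eq = contradiction (i , sym eq) x∉W
    points-inj (suc i) (suc j) eq = ≡.cong suc (W-inj i j eq)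

    points-root : ∀ i → L′ (points i) ≈ 0#
    points-root zero    = L′x≈0
    points-root (suc i) = W-root i

  -- A sum of two roots is a root by additivity, so it is listed up to double negation; finiteness
  -- collects all pairs under a single one.
  W-closed : ¬ ¬ (∀ i j → ∃ λ k → W i + W j ≈ W k)
  W-closed = ¬¬-choice λ i → ¬¬-choice λ j → W-complete
    (trans (L′-+ (W i) (W j)) (trans (+-cong (W-root i) (W-root j)) (+-identityˡ 0#)))

  module _ (closed : ∀ i j → ∃ λ k → W i + W j ≈ W k) where

    _∔_ : Fin (suc N) → Fin (suc N) → Fin (suc N)
    i ∔ j = proj₁ (closed i j)

    W-∔ : ∀ i j → W (i ∔ j) ≈ W i + W j
    W-∔ i j = sym (proj₂ (closed i j))

    root-group : BooleanGroup (suc N)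
    root-group = record
      { _⊕_         = _∔_
      ; 𝟘           = zero
      ; ⊕-assoc     = λ i j k → W-inj _ _ (begin
          W ((i ∔ j) ∔ k)    ≈⟨ trans (W-∔ (i ∔ j) k) (+-congʳ (W-∔ i j)) ⟩
          W i + W j + W k    ≈⟨ +-assoc (W i) (W j) (W k) ⟩
          W i + (W j + W k)  ≈⟨ trans (W-∔ i (j ∔ k)) (+-congˡ (W-∔ j k)) ⟨
          W (i ∔ (j ∔ k))    ∎)
      ; ⊕-comm      = λ i j → W-inj _ _ (trans (W-∔ i j) (trans (+-comm (W i) (W j)) (sym (W-∔ j i))))
      ; ⊕-identityˡ = λ i → W-inj _ _ (trans (W-∔ zero i) (+-identityˡ (W i)))
      ; ⊕-self      = λ i → W-inj _ _ (trans (W-∔ i i) (x+x≈0 char2 (W i)))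
      }

  module _ {τ : Carrier → Carrier} (τ-auto : IsFieldAuto K τ) (π : Fin N → Fin N) (τ-π : ∀ i → τ (r i) ≈ r (π i)) where
    open RingMorphisms.IsRingIsomorphism τ-auto

    fixing-zero-τ : ∀ i → τ (W i) ≈ W (fixing-zero π i)
    fixing-zero-τ zero    = 0#-homo
    fixing-zero-τ (suc i) = τ-π i

    -- Since `τ` is injective and `W` lists distinct roots, so is the map induced on indices.
    fixing-zero-inj : Injective _≡_ _≡_ (fixing-zero π)
    fixing-zero-inj {i} {j} eq = W-inj i j (injective (begin
      τ (W i)               ≈⟨ fixing-zero-τ i ⟩
      W (fixing-zero π i)   ≈⟨ reflexive (≡.cong W eq) ⟩
      W (fixing-zero π j)   ≈⟨ fixing-zero-τ j ⟨
      τ (W j)               ∎))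

    even-if-8∣qⁿ : 8 ∣ q ^ n → IsEven π
    even-if-8∣qⁿ 8∣qⁿ = IsEven-stable π (¬¬-map even W-closed)
      where
      module _ (closed : ∀ i j → ∃ λ k → W i + W j ≈ W k) where
        fixing-zero-hom : ∀ i j → fixing-zero π (proj₁ (closed i j)) ≡
                                  proj₁ (closed (fixing-zero π i) (fixing-zero π j))
        fixing-zero-hom i j = W-inj _ _ (begin
          W (fixing-zero π (proj₁ (closed i j)))         ≈⟨ fixing-zero-τ (proj₁ (closed i j)) ⟨
          τ (W (proj₁ (closed i j)))                     ≈⟨ ⟦⟧-cong (W-∔ closed i j) ⟩
          τ (W i + W j)                                  ≈⟨ +-homo (W i) (W j) ⟩
          τ (W i) + τ (W j)                              ≈⟨ +-cong (fixing-zero-τ i) (fixing-zero-τ j) ⟩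
          W (fixing-zero π i) + W (fixing-zero π j)      ≈⟨ proj₂ (closed (fixing-zero π i) (fixing-zero π j)) ⟩
          W (proj₁ (closed (fixing-zero π i) (fixing-zero π j))) ∎)

        even : IsEven π
        even = n∣m⇒m%n≡0 (inversions π) 2 (≡.subst (2 ∣_) (inversions-fixing-zero π)
          (automorphism-even (root-group closed) (≡.subst (8 ∣_) (≡.sym 1+N≡qⁿ) 8∣qⁿ)
            (fixing-zero π) fixing-zero-inj fixing-zero-hom))

-- The case `q = 4`, `n = 1`.

module _ {c₁ ℓ₁ c₂ ℓ₂ : Level} {F : Field c₁ ℓ₁} {K : Field c₂ ℓ₂} (char2F : Char2 F)
  (L : qPolynomial F 4 1) (S : SplittingFieldDistinct F K L) where

  open Field K hiding (zero)
  open FieldProperties K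
  open SplittingFieldDistinct S
  open GroupProperties +-group using (identityˡ-unique)
  open Roots {K = K} char2F {e = 2} z<s L S
  open SemiringSolver commutativeSemiring using (solve; _:+_; _:*_; _:=_)
  open SetoidReasoning setoid

  -- Multiplication by `γ` permutes the three nonzero roots cyclically, and it commutes with `τ`
  -- because `τ` fixes the image of `F`.
  even-if-q≡4 : ContainsFieldOfOrder F 4 → ∀ {τ} → IsFieldAuto K τ → (∀ a → τ (σ a) ≈ σ a) →
                (π : Fin 3 → Fin 3) → (∀ i → τ (r i) ≈ r (π i)) → IsEven π
  even-if-q≡4 C {τ} τ-auto τ-fixes π τ-π = IsEven-stable π (¬¬-map even (¬¬-choice scaled-root))
    where
    module F = Field F
    module σ = RingMorphisms.IsRingHomomorphism σ-hom
    module τ = RingMorphisms.IsRingIsomorphism τ-auto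
    γF = FieldProperties.order-4-generator F char2F C
    γ = σ (proj₁ γF)

    γ²≈γ+1 : γ * γ ≈ γ + 1#
    γ²≈γ+1 = begin
      γ * γ                       ≈⟨ σ.*-homo _ _ ⟨
      σ (proj₁ γF F.* proj₁ γF)   ≈⟨ σ.⟦⟧-cong (proj₂ γF) ⟩
      σ (proj₁ γF F.+ F.1#)       ≈⟨ σ.+-homo _ _ ⟩
      γ + σ F.1#                  ≈⟨ +-congˡ σ.1#-homo ⟩
      γ + 1#                      ∎

    -- The hypothesis of `L′-scale` for `q = 4`: squaring `γ² = γ + 1` gives `γ⁴ = γ² + 1 = γ`.
    γ⁴≈γ : pow K γ 4 ≈ γ
    γ⁴≈γ = begin
      γ * (γ * (γ * (γ * 1#)))    ≈⟨ *-congˡ (*-congˡ (*-congˡ (*-identityʳ γ))) ⟩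
      γ * (γ * (γ * γ))           ≈⟨ *-assoc γ γ (γ * γ) ⟨
      γ * γ * (γ * γ)             ≈⟨ *-cong γ²≈γ+1 γ²≈γ+1 ⟩
      (γ + 1#) * (γ + 1#)         ≈⟨ square-+ char2 γ 1# ⟩
      γ * γ + 1# * 1#             ≈⟨ +-cong γ²≈γ+1 (*-identityˡ 1#) ⟩
      γ + 1# + 1#                 ≈⟨ +-assoc γ 1# 1# ⟩
      γ + (1# + 1#)               ≈⟨ +-congˡ char2 ⟩
      γ + 0#                      ≈⟨ +-identityʳ γ ⟩
      γ                           ∎

    γ≉0 : ¬ γ ≈ 0#
    γ≉0 γ≈0 = 1≉0 (begin
      1#       ≈⟨ +-identityˡ 1# ⟨
      0# + 1#  ≈⟨ +-congʳ γ≈0 ⟨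
      γ + 1#   ≈⟨ γ²≈γ+1 ⟨
      γ * γ    ≈⟨ *-congʳ γ≈0 ⟩
      0# * γ   ≈⟨ zeroˡ γ ⟩
      0#       ∎)

    γ≉1 : ¬ γ ≈ 1#
    γ≉1 γ≈1 = 1≉0 (begin
      1#       ≈⟨ *-identityˡ 1# ⟨
      1# * 1#  ≈⟨ *-cong γ≈1 γ≈1 ⟨
      γ * γ    ≈⟨ γ²≈γ+1 ⟩
      γ + 1#   ≈⟨ +-congʳ γ≈1 ⟩
      1# + 1#  ≈⟨ char2 ⟩
      0#       ∎)

    γ²≉1 : ¬ γ * γ ≈ 1#
    γ²≉1 γ²≈1 = γ≉0 (identityˡ-unique γ 1# (trans (sym γ²≈γ+1) γ²≈1))

    -- By linearity `γ * r i` is a root, and it is nonzero, so its index in `W` is not `zero`.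
    scaled-root : ∀ i → ¬ ¬ ∃ λ j → γ * r i ≈ r j
    scaled-root i = ¬¬-map nonzero (W-complete
      (trans (L′-scale γ⁴≈γ (r i)) (trans (*-congˡ (r-root i)) (zeroʳ γ))))
      where
      nonzero : (∃ λ k → γ * r i ≈ W k) → ∃ λ j → γ * r i ≈ r j
      nonzero (zero  , eq) = contradiction eq (*-nonzero γ≉0 (r≉0 i))
      nonzero (suc j , eq) = j , eq

    scale-moves : ∀ {x} → ¬ x ≈ 1# → ∀ i → ¬ x * r i ≈ r i
    scale-moves x≉1 i eq = r≉0 i (*-injectiveˡ x≉1 (trans eq (sym (*-identityˡ (r i)))))

    even : (∀ i → ∃ λ j → γ * r i ≈ r j) → IsEven π
    even scaled = centralizer-of-3-cycle-even ρ π
      (λ i ρi≡i → scale-moves γ≉1 i (trans (ρ-scales i) (reflexive (≡.cong r ρi≡i))))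
      (λ i ρρi≡i → scale-moves γ²≉1 i (begin
        γ * γ * r i      ≈⟨ *-assoc γ γ (r i) ⟩
        γ * (γ * r i)    ≈⟨ *-congˡ (ρ-scales i) ⟩
        γ * r (ρ i)      ≈⟨ ρ-scales (ρ i) ⟩
        r (ρ (ρ i))      ≈⟨ reflexive (≡.cong r ρρi≡i) ⟩
        r i              ∎))
      (λ i → r-inj _ _ (begin
        r (π (ρ i))      ≈⟨ τ-π (ρ i) ⟨
        τ (r (ρ i))      ≈⟨ τ.⟦⟧-cong (ρ-scales i) ⟨
        τ (γ * r i)      ≈⟨ τ.*-homo γ (r i) ⟩
        τ γ * τ (r i)    ≈⟨ *-cong (τ-fixes (proj₁ γF)) (τ-π i) ⟩
        γ * r (π i)      ≈⟨ ρ-scales (π i) ⟩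
        r (ρ (π i))      ∎))
      where
      ρ : Fin 3 → Fin 3
      ρ i = proj₁ (scaled i)
      ρ-scales : ∀ i → γ * r i ≈ r (ρ i)
      ρ-scales i = proj₂ (scaled i)

-- Case distinction on `q` and `n`.

8∣[2^e]^n : ∀ e n → 3 ℕ.≤ e ℕ.* n → 8 ∣ (2 ^ e) ^ n
8∣[2^e]^n e n 3≤en = ≡.subst (8 ∣_) (≡.sym (ℕₚ.^-*-assoc 2 e n)) (m≤n⇒2^m∣2^n 3≤en)
  where
  m≤n⇒2^m∣2^n : ∀ {m n} → m ℕ.≤ n → 2 ^ m ∣ 2 ^ n
  m≤n⇒2^m∣2^n {n = n} z≤n   = 1∣ (2 ^ n)
  m≤n⇒2^m∣2^n (s≤s m≤n) = *-monoʳ-∣ 2 (m≤n⇒2^m∣2^n m≤n)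

theorem8 : {c₁ ℓ₁ c₂ ℓ₂ : Level} (F : Field c₁ ℓ₁) (K : Field c₂ ℓ₂)
    (e q n : ℕ) → q ≡ 2 ^ e → Char2 F → ContainsFieldOfOrder F q →
    (L : qPolynomial F q n) → (S : SplittingFieldDistinct F K L) →
    ¬ (q ≡ 2 × n ≡ 2) →
    (τ : Field.Carrier K → Field.Carrier K) → IsFieldAuto K τ →
    (∀ a → Field._≈_ K (τ (SplittingFieldDistinct.σ S a)) (SplittingFieldDistinct.σ S a)) →
    (π : Fin (q ^ n ∸ 1) → Fin (q ^ n ∸ 1)) →
    (∀ i → Field._≈_ K (τ (SplittingFieldDistinct.r S i)) (SplittingFieldDistinct.r S (π i))) →
    IsEven π
-- Here `q = 1`, and a field of order 1 would have 0 and 1 equal.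
theorem8 F K 0 _ n ≡.refl char2 C L S _ τ τ-auto τ-fixes π τ-π =
  contradiction (trivial (proj₁ has-0) (proj₁ has-1) (proj₂ has-0) (proj₂ has-1)) (Field.1≉0 F)
  where
  open ContainsFieldOfOrder C
  open Field F using (_≈_; 0#; 1#; trans; sym)
  trivial : ∀ i j → ι i ≈ 0# → ι j ≈ 1# → 1# ≈ 0#
  trivial 0F 0F ι≈0 ι≈1 = trans (sym ι≈1) ι≈0
theorem8 F K _ _ 0 ≡.refl char2 C L S _ τ τ-auto τ-fixes π τ-π = ≡.refl
-- A single nonzero root admits no inversion.
theorem8 F K 1 _ 1 ≡.refl char2 C L S _ τ τ-auto τ-fixes π τ-π = ≡.refl
theorem8 F K 1 _ 2 ≡.refl char2 C L S ≢2 τ τ-auto τ-fixes π τ-π = contradiction (≡.refl , ≡.refl) ≢2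
theorem8 F K 2 _ 1 ≡.refl char2 C L S _ τ τ-auto τ-fixes π τ-π =
  even-if-q≡4 char2 L S C τ-auto τ-fixes π τ-π
-- From here on `e * n` is at least 3, so 8 divides `q ^ n`.
theorem8 F K 1 _ (suc (suc (suc n))) ≡.refl char2 C L S _ τ τ-auto τ-fixes π τ-π =
  Roots.even-if-8∣qⁿ {K = K} char2 {e = 1} z<s L S τ-auto π τ-π
    (8∣[2^e]^n 1 (3 ℕ.+ n) (s≤s (s≤s (s≤s z≤n))))
theorem8 F K 2 _ (suc (suc n)) ≡.refl char2 C L S _ τ τ-auto τ-fixes π τ-π =
  Roots.even-if-8∣qⁿ {K = K} char2 {e = 2} z<s L S τ-auto π τ-π
    (8∣[2^e]^n 2 (2 ℕ.+ n) (ℕₚ.≤-trans (ℕₚ.n≤1+n 3) (ℕₚ.*-monoʳ-≤ 2 (ℕₚ.m≤m+n 2 n))))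
theorem8 F K (suc (suc (suc e))) _ (suc n) ≡.refl char2 C L S _ τ τ-auto τ-fixes π τ-π =
  Roots.even-if-8∣qⁿ {K = K} char2 {e = 3 ℕ.+ e} z<s L S τ-auto π τ-π
    (8∣[2^e]^n (3 ℕ.+ e) (suc n) (ℕₚ.*-mono-≤ (ℕₚ.m≤m+n 3 e) (ℕₚ.m≤m+n 1 n)))
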